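{- Let $n, k$ be integers with $0 \le k \le n$. Let $n=\sum_{i\ge 0} n_i 5^i$, $n-k=\sum_{i\ge 0} m_i 5^i$ and $k=\sum_{i\ge 0} k_i 5^i$ be the base-5 expansions of $n$, $n-k$ and $k$ (so $0\le n_i, m_i, k_i\le 4$ for all $i$). Then $$5 \mid \binom{n}{k}_F \iff 5 \mid \binom{n_0}{k_0}_F\binom{n_1}{k_1}_F\binom{n_2}{k_2}_F\cdots.$$
   Context: The Fibonacci sequence is $F_1=F_2=1$, $F_n=F_{n-1}+F_{n-2}$ for $n\ge 3$. The fibotorial is $n!_F = F_nF_{n-1}\cdots F_1$ for $n>0$, and $0!_F=1$. The fibonomial coefficient is $\binom{n}{k}_F=\frac{n!_F}{k!_F\,(n-k)!_F}$ for $0\le k\le n$, and $\binom{n}{k}_F=0$ otherwise; it is always an integer. In the product, all but finitely many digits are zero and $\binom{0}{0}_F=1$, so the product is finite. -}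

module Defs where

open import Data.Bool.Base using (if_then_else_; true)
open import Data.Digit using (Digit)
open import Data.Fin.Base using (toℕ)
open import Data.List.Base using (applyUpTo)
open import Data.Nat.Base
open import Data.Nat.DivMod using (m/n*n≡m)
open import Data.Nat.Divisibility
  using (_∣_; ∣m∣n⇒∣m+n; ∣n⇒∣m*n; *-monoʳ-∣; ∣-reflexive; ∣-trans)
open import Data.Nat.ListAction using (sum; product)
open import Data.Nat.Properties
open import Data.Nat.Tactic.RingSolver using (solve-∀)
open import Data.Product.Base using (_×_)
open import Relation.Binary.PropositionalEquality

-- Extended by F₀ = 0; the fibotorial below only involves F₁, F₂, ….
fib : ℕ → ℕ
fib zero          = 0
fib (suc zero)    = 1
fib (suc (suc n)) = fib (suc n) + fib n

infix 8 _!F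

_!F : ℕ → ℕ
zero  !F = 1
suc n !F = fib (suc n) * n !F

fib-suc≢0 : ∀ n → NonZero (fib (suc n))
fib-suc≢0 zero    = _
fib-suc≢0 (suc n) = >-nonZero (≤-trans (>-nonZero⁻¹ _ {{fib-suc≢0 n}}) (m≤m+n _ _))

_!F≢0 : ∀ n → NonZero (n !F)
zero  !F≢0 = _
suc n !F≢0 = m*n≢0 _ _ {{fib-suc≢0 n}} {{n !F≢0}}

-- For k ≤ n the truncated division _/_ is exact: see fibonomial-exact.
fibonomial : ℕ → ℕ → ℕ
fibonomial n k = if k ≤ᵇ n then n !F / (k !F * (n ∸ k) !F) else 0
  where instance _ = m*n≢0 _ _ {{k !F≢0}} {{(n ∸ k) !F≢0}}

fib-+ : ∀ m n → fib (m + suc n) ≡ fib m * fib n + fib (suc m) * fib (suc n)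
fib-+ zero          n = sym (+-identityʳ _)
fib-+ (suc zero)    n = lemma (fib (suc n)) (fib n)
  where
  lemma : ∀ a b → a + b ≡ 1 * b + 1 * a
  lemma = solve-∀
fib-+ (suc (suc m)) n
  rewrite fib-+ (suc m) n | fib-+ m n
  = lemma (fib (suc m)) (fib m) (fib n) (fib (suc n))
  where
  lemma : ∀ a b c d → (a * c + (a + b) * d) + (b * c + a * d)
                    ≡ (a + b) * c + ((a + b) + a) * d
  lemma = solve-∀

!F*!F∣!F : ∀ k m → k !F * m !F ∣ (k + m) !F
!F*!F∣!F zero    m    = ∣-reflexive (+-identityʳ _)
!F*!F∣!F (suc k) zero =
  ∣-reflexive (trans (*-identityʳ _) (cong _!F (sym (+-identityʳ (suc k)))))
!F*!F∣!F (suc k) (suc m) = subst (suc k !F * suc m !F ∣_) (sym split)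
  (∣m∣n⇒∣m+n
    (∣n⇒∣m*n (fib m)
      (∣-trans (∣-reflexive (*-assoc (fib (suc k)) (k !F) (suc m !F)))
               (*-monoʳ-∣ (fib (suc k)) (!F*!F∣!F k (suc m)))))
    (∣n⇒∣m*n (fib (suc (suc k)))
      (∣-trans (∣-reflexive (swap (suc k !F) (fib (suc m)) (m !F)))
               (*-monoʳ-∣ (fib (suc m)) (!F*!F∣!F (suc k) m)))))
  where
  swap : ∀ a b c → a * (b * c) ≡ b * (a * c)
  swap = solve-∀

  dist : ∀ a b c d x → (a * b + c * d) * x ≡ b * (a * x) + c * (d * x)
  dist = solve-∀

  split : (suc k + suc m) !F
        ≡ fib m * (fib (suc k) * (k + suc m) !F)
          + fib (suc (suc k)) * (fib (suc m) * (suc k + m) !F)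
  split = begin
    fib (suc k + suc m) * (k + suc m) !F
      ≡⟨ cong (_* (k + suc m) !F) (fib-+ (suc k) m) ⟩
    (fib (suc k) * fib m + fib (suc (suc k)) * fib (suc m)) * (k + suc m) !F
      ≡⟨ dist (fib (suc k)) (fib m) (fib (suc (suc k))) (fib (suc m)) _ ⟩
    fib m * (fib (suc k) * (k + suc m) !F)
      + fib (suc (suc k)) * (fib (suc m) * (k + suc m) !F)
      ≡⟨ cong (λ j → fib m * (fib (suc k) * (k + suc m) !F)
                     + fib (suc (suc k)) * (fib (suc m) * j !F)) (+-suc k m) ⟩
    fib m * (fib (suc k) * (k + suc m) !F)
      + fib (suc (suc k)) * (fib (suc m) * (suc k + m) !F) ∎
    where open ≡-Reasoning

fibonomial-exact : ∀ {n k} → k ≤ n → fibonomial n k * (k !F * (n ∸ k) !F) ≡ n !F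
fibonomial-exact {n} {k} k≤n with k ≤ᵇ n | ≤⇒≤ᵇ k≤n
... | true | _ = m/n*n≡m
  (subst (λ j → k !F * (n ∸ k) !F ∣ j !F) (m+[n∸m]≡n k≤n) (!F*!F∣!F k (n ∸ k)))
  where instance _ = m*n≢0 _ _ {{k !F≢0}} {{(n ∸ k) !F≢0}}

-- n = Σ_{i ≥ 0} dᵢ bⁱ for a digit sequence d whose digits from position N
-- on are all zero, so that the sum may be cut off at N.
IsExpansion : (b N : ℕ) → (ℕ → Digit b) → ℕ → Set
IsExpansion b N d n =
  (∀ i → N ≤ i → toℕ (d i) ≡ 0) × n ≡ sum (applyUpTo (λ i → toℕ (d i) * b ^ i) N)

-- The product over all i ≥ 0, cut off at N: if n′ and k′ vanish from N on,
-- the omitted factors are all fibonomial 0 0 = 1.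
digitProduct : ∀ {b} → ℕ → (n′ k′ : ℕ → Digit b) → ℕ
digitProduct N n′ k′ = product (applyUpTo (λ i → fibonomial (toℕ (n′ i)) (toℕ (k′ i))) N)

-- Writing n = r + 5q with r < 5, the 5-adic valuation of n!F is that of 5^q * q!F:
-- 5 ∤ fib j unless 5 ∣ j, and fib (5q) = 5 * fib q * u with 5 ∤ u.  If the lowest
-- digits of k and n − k add up without a carry, the factors 5^q cancel and
-- fibonomial n k is, up to factors prime to 5, the fibonomial of the quotients.
-- If they carry, one factor 5 is left over in fibonomial n k, while the lowest
-- digit of k exceeds that of n, so that the digit product is 0.
module Submission where

open import Defs
open import Data.Bool.Base using (T; true; false)
open import Data.Digit using (Digit)
open import Data.Fin.Base using (toℕ)
open import Data.Fin.Properties using (toℕ<n)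
open import Data.List.Base using (applyUpTo)
open import Data.Nat.Base
  using (ℕ; zero; suc; _≤_; _<_; _∸_; _+_; _*_; _^_; _≤ᵇ_; NonZero)
open import Data.Nat.Divisibility
open import Data.Nat.DivMod using (_%_; [m+kn]%n≡m%n; m<n⇒m%n≡m)
open import Data.Nat.ListAction using (sum)
open import Data.Nat.Primality using (Prime; prime?; euclidsLemma)
open import Data.Nat.Properties
open import Data.Nat.Tactic.RingSolver using (solve-∀)
open import Data.Product.Base using (_×_; _,_; proj₁; proj₂; ∃-syntax)
open import Data.Sum.Base using ([_,_]′)
open import Data.Unit.Base using (tt)
open import Function.Base using (_∘_; id)
open import Function.Bundles using (_⇔_; mk⇔; module Equivalence)
open import Function.Construct.Composition using (_⇔-∘_)
open import Function.Construct.Symmetry using (⇔-sym)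
open import Relation.Binary.PropositionalEquality
open import Relation.Nullary.Decidable using (Dec; yes; no; toWitness; from-no)
open import Relation.Nullary.Negation using (contradiction)

-- Divisibility by the prime 5.

prime-5 : Prime 5
prime-5 = toWitness {a? = prime? 5} tt

5∤1 : 5 ∤ 1
5∤1 = from-no (5 ∣? 1)

5∤* : ∀ {m n} → 5 ∤ m → 5 ∤ n → 5 ∤ m * n
5∤* {m} {n} 5∤m 5∤n = [ 5∤m , 5∤n ]′ ∘ euclidsLemma m n prime-5

5∣m*n⇔5∣m : ∀ {m n} → 5 ∤ n → 5 ∣ m * n ⇔ 5 ∣ m
5∣m*n⇔5∣m {m} {n} 5∤n =
  mk⇔ ([ id , (λ 5∣n → contradiction 5∣n 5∤n) ]′ ∘ euclidsLemma m n prime-5)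
      (∣m⇒∣m*n n)

5∣m*n⇔5∣n : ∀ {m n} → 5 ∤ m → 5 ∣ m * n ⇔ 5 ∣ n
5∣m*n⇔5∣n {m} {n} 5∤m =
  subst (λ x → 5 ∣ x ⇔ 5 ∣ n) (*-comm n m) (5∣m*n⇔5∣m 5∤m)

-- Fibonacci numbers and divisibility by 5.

-- Unfolding gives `fib (5 + n) ≡ 5 * fib (suc n) + 3 * fib n`, and 3 is prime to 5.
5∣fib[5+n]⇒5∣fib[n] : ∀ n → 5 ∣ fib (5 + n) → 5 ∣ fib n
5∣fib[5+n]⇒5∣fib[n] n 5∣fib =
  [ (λ 5∣3 → contradiction 5∣3 (from-no (5 ∣? 3))) , id ]′
    (euclidsLemma 3 (fib n) prime-5
      (∣m+n∣m⇒∣n (subst (5 ∣_) (lemma (fib (suc n)) (fib n)) 5∣fib)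
                  (m∣m*n (fib (suc n)))))
  where
  lemma : ∀ b a → (((b + a) + b) + (b + a)) + ((b + a) + b) ≡ 5 * b + 3 * a
  lemma = solve-∀

5∣fib[r+q*5]⇒5∣fib[r] : ∀ r q → 5 ∣ fib (r + q * 5) → 5 ∣ fib r
5∣fib[r+q*5]⇒5∣fib[r] r zero    = subst (λ j → 5 ∣ fib j) (+-identityʳ r)
5∣fib[r+q*5]⇒5∣fib[r] r (suc q) =
  5∣fib[r+q*5]⇒5∣fib[r] r q ∘ 5∣fib[5+n]⇒5∣fib[n] (r + q * 5)
  ∘ subst (λ j → 5 ∣ fib j) (lemma r (q * 5))
  where
  lemma : ∀ a b → a + (5 + b) ≡ 5 + (a + b)
  lemma = solve-∀

5∤fib[1+r] : ∀ {r} → suc r < 5 → 5 ∤ fib (suc r)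
5∤fib[1+r] {0} _ = 5∤1
5∤fib[1+r] {1} _ = 5∤1
5∤fib[1+r] {2} _ = from-no (5 ∣? 2)
5∤fib[1+r] {3} _ = from-no (5 ∣? 3)
5∤fib[1+r] {suc (suc (suc (suc r)))} r<5 = contradiction r<5 (≤⇒≯ (m≤m+n 5 r))

-- With φ² = φ + 1 and x, a = fib p, fib (suc p) we have φ ^ suc p = x + a φ, and
-- the coefficient of φ in (x + a φ)⁵ is 5 a * quintuple x a.  Modulo 5, quintuple x a
-- is (x² + x a − a²)², which (x , a) ↦ (a , a + x) leaves unchanged.
quintuple : ℕ → ℕ → ℕ
quintuple x a =
  x * x * x * x + 2 * (x * x * x * a) + 4 * (x * x * a * a) + 3 * (x * a * a * a)
  + a * a * a * a

5∤quintuple-fib : ∀ p → 5 ∤ quintuple (fib p) (fib (suc p))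
5∤quintuple-fib zero    = 5∤1
5∤quintuple-fib (suc p) 5∣u = 5∤quintuple-fib p
  (∣m+n∣m⇒∣n (subst (5 ∣_) (step (fib p) (fib (suc p))) 5∣u)
              (m∣m*n (growth (fib p) (fib (suc p)))))
  where
  -- One fifth of the difference between consecutive values of `quintuple`.
  growth : ℕ → ℕ → ℕ
  growth x a =
    2 * (a * a * a * a) + 4 * (a * a * a * x) + 3 * (a * a * x * x) + a * x * x * x

  step : ∀ x a →
    a * a * a * a + 2 * (a * a * a * (a + x)) + 4 * (a * a * (a + x) * (a + x))
    + 3 * (a * (a + x) * (a + x) * (a + x)) + (a + x) * (a + x) * (a + x) * (a + x)
    ≡ 5 * (2 * (a * a * a * a) + 4 * (a * a * a * x) + 3 * (a * a * x * x)
           + a * x * x * x)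
      + (x * x * x * x + 2 * (x * x * x * a) + 4 * (x * x * a * a)
         + 3 * (x * a * a * a) + a * a * a * a)
  step = solve-∀

fib-*5 : ∀ p → fib (suc p * 5) ≡ 5 * (fib (suc p) * quintuple (fib p) (fib (suc p)))
fib-*5 p = trans (cong fib (indices p)) expand
  where
  -- This bracketing keeps the right summand a successor, as `fib-+` needs, until only `fib p` and
  -- `fib (suc p)` remain.
  indices : ∀ p → suc p * 5 ≡ (suc p + suc p) + suc (p + suc (p + suc p))
  indices = solve-∀

  polynomial : ∀ x a →
    (a * x + (a + x) * a) * (x * (x * x + a * a) + a * (a * x + (a + x) * a))
    + ((a * x + (a + x) * a) + (x * x + a * a))
      * (a * (x * x + a * a) + (a + x) * (a * x + (a + x) * a))
    ≡ 5 * (a * (x * x * x * x + 2 * (x * x * x * a) + 4 * (x * x * a * a)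
                + 3 * (x * a * a * a) + a * a * a * a))
  polynomial = solve-∀

  expand : fib ((suc p + suc p) + suc (p + suc (p + suc p)))
         ≡ 5 * (fib (suc p) * quintuple (fib p) (fib (suc p)))
  expand
    rewrite fib-+ (suc p + suc p) (p + suc (p + suc p))
          | fib-+ p (p + suc p) | fib-+ (suc p) (p + suc p)
          | fib-+ p p | fib-+ (suc p) p
    = polynomial (fib p) (fib (suc p))

-- The power of 5 in a fibotorial.

-- The extra factors have indices strictly between `q * 5` and `5 + q * 5`, so each is prime to 5.
!F-digit-extend : ∀ q r → r < 5 →
  ∃[ u ] 5 ∤ u × (r + q * 5) !F ≡ u * (q * 5) !F
!F-digit-extend q zero    _   = 1 , 5∤1 , sym (*-identityˡ _)
!F-digit-extend q (suc r) r<5 with !F-digit-extend q r (<-trans (n<1+n r) r<5)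
... | u , 5∤u , eq =
  fib (suc r + q * 5) * u ,
  5∤* (5∤fib[1+r] r<5 ∘ 5∣fib[r+q*5]⇒5∣fib[r] (suc r) q) 5∤u ,
  trans (cong (fib (suc r + q * 5) *_) eq) (sym (*-assoc (fib (suc r + q * 5)) u _))

-- In each block of five consecutive factors, only the one whose index is a multiple of 5 is
-- divisible by 5, and `fib-*5` splits it.
[q*5]!F-split : ∀ q → ∃[ u ] 5 ∤ u × (q * 5) !F ≡ 5 ^ q * q !F * u
[q*5]!F-split zero    = 1 , 5∤1 , refl
[q*5]!F-split (suc q)
  with [q*5]!F-split q | !F-digit-extend q 4 (n<1+n 4)
... | u , 5∤u , eq | v , 5∤v , extend =
  w * (v * u) , 5∤* (5∤quintuple-fib q) (5∤* 5∤v 5∤u) , (begin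
    fib (suc q * 5) * (4 + q * 5) !F
      ≡⟨ cong₂ _*_ (fib-*5 q) (trans extend (cong (v *_) eq)) ⟩
    5 * (fib (suc q) * w) * (v * (5 ^ q * q !F * u))
      ≡⟨ lemma (fib (suc q)) w v (5 ^ q) (q !F) u ⟩
    5 * 5 ^ q * (fib (suc q) * q !F) * (w * (v * u)) ∎)
  where
  open ≡-Reasoning
  w = quintuple (fib q) (fib (suc q))

  lemma : ∀ f w v s t u →
    5 * (f * w) * (v * (s * t * u)) ≡ 5 * s * (f * t) * (w * (v * u))
  lemma = solve-∀

!F-split : ∀ q r → r < 5 → ∃[ u ] 5 ∤ u × (r + q * 5) !F ≡ 5 ^ q * q !F * u
!F-split q r r<5 with [q*5]!F-split q | !F-digit-extend q r r<5
... | u , 5∤u , eq | v , 5∤v , extend =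
  v * u , 5∤* 5∤v 5∤u ,
  trans extend (trans (cong (v *_) eq) (lemma v (5 ^ q * q !F) u))
  where
  lemma : ∀ a b c → a * (b * c) ≡ b * (a * c)
  lemma = solve-∀

-- The coefficient divides `n !F`, a product of factors prime to 5.
5∤fibonomial-digit : ∀ {n k} → n < 5 → k ≤ n → 5 ∤ fibonomial n k
5∤fibonomial-digit {n} n<5 k≤n 5∣fib with !F-digit-extend 0 n n<5
... | u , 5∤u , eq = 5∤u (subst (5 ∣_) n!F≡u (∣m⇒∣m*n _ 5∣fib))
  where
  n!F≡u = trans (fibonomial-exact k≤n)
    (trans (cong _!F (sym (+-identityʳ n))) (trans eq (*-identityʳ u)))

fibonomial≡0 : ∀ {n k} → n < k → fibonomial n k ≡ 0
fibonomial≡0 {n} {k} n<k with k ≤ᵇ n in eq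
... | true  = contradiction (≤ᵇ⇒≤ k n (subst T (sym eq) tt)) (<⇒≱ n<k)
... | false = refl

-- Base-5 expansions.

digits-unique : ∀ {r s q t} → r < 5 → s < 5 → r + q * 5 ≡ s + t * 5 → r ≡ s × q ≡ t
digits-unique {r} {s} {q} {t} r<5 s<5 eq =
  r≡s , *-cancelʳ-≡ q t 5 (+-cancelˡ-≡ s _ _ (trans (cong (_+ q * 5) (sym r≡s)) eq))
  where
  r≡s : r ≡ s
  r≡s = begin
    r               ≡⟨ m<n⇒m%n≡m r<5 ⟨
    r % 5           ≡⟨ [m+kn]%n≡m%n r q 5 ⟨
    (r + q * 5) % 5 ≡⟨ cong (_% 5) eq ⟩
    (s + t * 5) % 5 ≡⟨ [m+kn]%n≡m%n s t 5 ⟩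
    s % 5           ≡⟨ m<n⇒m%n≡m s<5 ⟩
    s               ∎
    where open ≡-Reasoning

sum-applyUpTo-*ʳ : ∀ {f g} c → (∀ i → f i ≡ g i * c) →
  ∀ N → sum (applyUpTo f N) ≡ sum (applyUpTo g N) * c
sum-applyUpTo-*ʳ         c f≡g*c zero    = refl
sum-applyUpTo-*ʳ {g = g} c f≡g*c (suc N) =
  trans (cong₂ _+_ (f≡g*c 0) (sum-applyUpTo-*ʳ c (f≡g*c ∘ suc) N))
        (sym (*-distribʳ-+ c (g 0) _))

digitSum : ℕ → (ℕ → Digit 5) → ℕ
digitSum N d = sum (applyUpTo (λ i → toℕ (d i) * 5 ^ i) N)

digitSum-suc : ∀ N d → digitSum (suc N) d ≡ toℕ (d 0) + digitSum N (d ∘ suc) * 5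
digitSum-suc N d =
  cong₂ _+_ (*-identityʳ (toℕ (d 0)))
    (sum-applyUpTo-*ʳ 5 (λ i → lemma (toℕ (d (suc i))) (5 ^ i)) N)
  where
  lemma : ∀ a b → a * (5 * b) ≡ a * b * 5
  lemma = solve-∀

-- Splitting off the lowest digit.

-- Cancelling `5 ^ s * s !F * (5 ^ t * t !F)` leaves `B * (u * v) ≡ w * c`, where `u`, `v`, `c` are
-- prime to 5.
5∣quotient⇔ : ∀ s t {x y z u v c} B w → 5 ∤ u → 5 ∤ v → 5 ∤ c →
  x ≡ 5 ^ s * s !F * u → y ≡ 5 ^ t * t !F * v →
  z ≡ 5 ^ (s + t) * (w * (s !F * t !F)) * c →
  B * (x * y) ≡ z → 5 ∣ B ⇔ 5 ∣ w
5∣quotient⇔ s t {x} {y} {z} {u} {v} {c} B w 5∤u 5∤v 5∤c x≡ y≡ z≡ B*xy≡z =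
  5∣m*n⇔5∣m 5∤c ⇔-∘ subst (λ j → 5 ∣ B ⇔ 5 ∣ j) B*uv≡w*c (⇔-sym (5∣m*n⇔5∣m (5∤* 5∤u 5∤v)))
  where
  open ≡-Reasoning
  P = 5 ^ s * s !F * (5 ^ t * t !F)

  instance
    P≢0 : NonZero P
    P≢0 = m*n≢0 _ _ {{m*n≢0 _ _ {{m^n≢0 5 s}} {{s !F≢0}}}}
                    {{m*n≢0 _ _ {{m^n≢0 5 t}} {{t !F≢0}}}}

  left : ∀ a b d e B u v →
    B * (u * v) * (a * b * (d * e)) ≡ B * (a * b * u * (d * e * v))
  left = solve-∀

  right : ∀ a b d e w c → a * d * (w * (b * e)) * c ≡ w * c * (a * b * (d * e))
  right = solve-∀

  B*uv≡w*c : B * (u * v) ≡ w * c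
  B*uv≡w*c = *-cancelʳ-≡ _ _ P (begin
    B * (u * v) * P
      ≡⟨ left (5 ^ s) (s !F) (5 ^ t) (t !F) B u v ⟩
    B * (5 ^ s * s !F * u * (5 ^ t * t !F * v))
      ≡⟨ cong (B *_) (cong₂ _*_ x≡ y≡) ⟨
    B * (x * y)
      ≡⟨ trans B*xy≡z z≡ ⟩
    5 ^ (s + t) * (w * (s !F * t !F)) * c
      ≡⟨ cong (λ j → j * (w * (s !F * t !F)) * c) (^-distribˡ-+-* 5 s t) ⟩
    5 ^ s * 5 ^ t * (w * (s !F * t !F)) * c
      ≡⟨ right (5 ^ s) (s !F) (5 ^ t) (t !F) w c ⟩
    w * c * P ∎)

5∣quotient-no-carry : ∀ {q} s t {r a b} B C → r < 5 → a < 5 → b < 5 →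
  q ≡ s + t → C * (s !F * t !F) ≡ q !F →
  B * ((a + s * 5) !F * (b + t * 5) !F) ≡ (r + q * 5) !F → 5 ∣ B ⇔ 5 ∣ C
5∣quotient-no-carry s t {r} {a} {b} B C r<5 a<5 b<5 refl C*≡ B*≡
  with !F-split s a a<5 | !F-split t b b<5 | !F-split (s + t) r r<5
... | u , 5∤u , x≡ | v , 5∤v , y≡ | c , 5∤c , z≡ =
  5∣quotient⇔ s t B C 5∤u 5∤v 5∤c x≡ y≡
    (trans z≡ (cong (λ j → 5 ^ (s + t) * j * c) (sym C*≡))) B*≡

-- The carry makes the exponent of 5 on the right one larger than `s + t`; this spare 5 goes into
-- the cofactor `w`.
5∣quotient-carry : ∀ {q} s t {r a b} B → r < 5 → a < 5 → b < 5 → q ≡ suc (s + t) →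
  B * ((a + s * 5) !F * (b + t * 5) !F) ≡ (r + q * 5) !F → 5 ∣ B
5∣quotient-carry s t {r} {a} {b} B r<5 a<5 b<5 refl B*≡
  with !F-split s a a<5 | !F-split t b b<5 | !F-split (suc (s + t)) r r<5
     | !F*!F∣!F s t
... | u , 5∤u , x≡ | v , 5∤v , y≡ | c , 5∤c , z≡ | divides C C≡ =
  Equivalence.from
    (5∣quotient⇔ s t B (5 * (f * C)) 5∤u 5∤v 5∤c x≡ y≡
      (trans z≡ (trans (cong (λ j → 5 ^ suc (s + t) * (f * j) * c) C≡)
        (lemma (5 ^ (s + t)) f C (s !F * t !F) c))) B*≡)
    (m∣m*n (f * C))
  where
  f = fib (suc (s + t))

  lemma : ∀ p f C d c → 5 * p * (f * (C * d)) * c ≡ p * (5 * (f * C) * d) * c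
  lemma = solve-∀

-- Induction on the number of digits. The coefficient enters as any `B` satisfying its product
-- equation, so the quotient supplied by `!F*!F∣!F` can take its place in the recursive call.
5∣quotient⇔5∣digitProduct : ∀ N (n′ m′ k′ : ℕ → Digit 5) B →
  digitSum N n′ ≡ digitSum N k′ + digitSum N m′ →
  B * (digitSum N k′ !F * digitSum N m′ !F) ≡ digitSum N n′ !F →
  5 ∣ B ⇔ 5 ∣ digitProduct N n′ k′
5∣quotient⇔5∣digitProduct zero n′ m′ k′ B _ B*1≡1 =
  -- Without digits all three fibotorials are 1, so `B` is 1, the empty product.
  subst (λ j → 5 ∣ B ⇔ 5 ∣ j) (trans (sym (*-identityʳ B)) B*1≡1) (mk⇔ id id)
5∣quotient⇔5∣digitProduct (suc N) n′ m′ k′ B sum≡ B*≡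
  rewrite digitSum-suc N n′ | digitSum-suc N m′ | digitSum-suc N k′
  = by-carry (a + b <? 5)
  where
  r = toℕ (n′ 0)
  a = toℕ (k′ 0)
  b = toℕ (m′ 0)
  q = digitSum N (n′ ∘ suc)
  s = digitSum N (k′ ∘ suc)
  t = digitSum N (m′ ∘ suc)
  r<5 = toℕ<n (n′ 0)
  a<5 = toℕ<n (k′ 0)
  b<5 = toℕ<n (m′ 0)

  regroup : ∀ a s b t → (a + s * 5) + (b + t * 5) ≡ (a + b) + (s + t) * 5
  regroup = solve-∀

  total : r + q * 5 ≡ (a + b) + (s + t) * 5
  total = trans sum≡ (regroup a s b t)

  by-carry : Dec (a + b < 5) → 5 ∣ B ⇔ 5 ∣ digitProduct (suc N) n′ k′
  by-carry (yes a+b<5) with digits-unique r<5 a+b<5 total | !F*!F∣!F s t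
  ... | r≡a+b , q≡s+t | divides C C≡ =
    ⇔-sym (5∣m*n⇔5∣n (5∤fibonomial-digit r<5 (subst (a ≤_) (sym r≡a+b) (m≤m+n a b))))
    ⇔-∘ (5∣quotient⇔5∣digitProduct N (n′ ∘ suc) (m′ ∘ suc) (k′ ∘ suc) C q≡s+t C*≡
         ⇔-∘ 5∣quotient-no-carry s t B C r<5 a<5 b<5 q≡s+t C*≡ B*≡)
    where
    C*≡ : C * (s !F * t !F) ≡ q !F
    C*≡ = trans (sym C≡) (cong _!F (sym q≡s+t))
  by-carry (no a+b≮5) with m≤n⇒∃[o]m+o≡n (≮⇒≥ a+b≮5)
  ... | e , 5+e≡a+b =
    -- Both sides hold outright: the lowest factor of the digit product is 0, and the carry puts a 5
    -- into `B`.
    mk⇔ (λ _ → ∣m⇒∣m*n _ (subst (5 ∣_) (sym (fibonomial≡0 r<a)) (5 ∣0)))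
        (λ _ → 5∣quotient-carry s t B r<5 a<5 b<5 (proj₂ digits) B*≡)
    where
    -- As `a + b < 10`, the carry is exactly 1 and `e` is a genuine digit.
    e<5 : e < 5
    e<5 = +-cancelˡ-< 5 e 5 (subst (_< 10) (sym 5+e≡a+b) (+-mono-< a<5 b<5))

    move-carry : ∀ e j → (5 + e) + j * 5 ≡ e + (1 + j) * 5
    move-carry = solve-∀

    digits : r ≡ e × q ≡ suc (s + t)
    digits = digits-unique r<5 e<5
      (trans total (trans (cong (_+ (s + t) * 5) (sym 5+e≡a+b)) (move-carry e (s + t))))

    r<a : r < a
    r<a = +-cancelʳ-< 5 r a (begin-strict
      r + 5 ≡⟨ cong (_+ 5) (proj₁ digits) ⟩
      e + 5 ≡⟨ +-comm e 5 ⟩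
      5 + e ≡⟨ 5+e≡a+b ⟩
      a + b <⟨ +-monoʳ-< a b<5 ⟩
      a + 5 ∎)
      where open ≤-Reasoning

lemma3p1 : (n k : ℕ) → k ≤ n →
    (N : ℕ) (n′ m′ k′ : ℕ → Digit 5) →
    IsExpansion 5 N n′ n →
    IsExpansion 5 N m′ (n ∸ k) →
    IsExpansion 5 N k′ k →
    5 ∣ fibonomial n k ⇔ 5 ∣ digitProduct N n′ k′
lemma3p1 n k k≤n N n′ m′ k′ (_ , n≡) (_ , m≡) (_ , k≡) =
  5∣quotient⇔5∣digitProduct N n′ m′ k′ (fibonomial n k)
    (trans (sym n≡) (trans (sym (m+[n∸m]≡n k≤n)) (cong₂ _+_ k≡ m≡)))
    (trans (cong (fibonomial n k *_) (cong₂ (λ i j → i !F * j !F) (sym k≡) (sym m≡)))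
      (trans (fibonomial-exact k≤n) (cong _!F n≡)))
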